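{- Let $r$ and $k$ be positive integers with $k>r\ge 2$, and let $G$ be a graph with $\chi(G)\le r$. Let $P\subset V(G)$ and let $d\colon P\to[r+k]$ be a precoloring of $P$ in $G$. (1) If $r<k\le\frac{3r-7}{2}$ and $|\mathcal{D}_G(P,2)|<\min\left\{\frac12(k+3r-4)(k-r+3),\ (k-r+2)(k+r-1)\right\}$, then $d$ can be extended to an $(r+k)$-coloring of $G$. (2) If $k>\frac{3r-7}{2}$ and $|\mathcal{D}_G(P,2)|<\min\left\{\frac12(k+1)(k+2),\ (k-r+2)(k+r-1)\right\}$, then $d$ can be extended to an $(r+k)$-coloring of $G$.
   Context: For a graph $G$, $P\subset V(G)$ and a positive integer $k$, $\mathcal{D}_G(P,k)=\{\{x,y\}\subset P: x\ne y,\ d_G(x,y)\le k\}$, where $d_G$ is the distance in $G$. $[m]=\{1,\dots,m\}$. A precoloring of $P$ in $G$ is a proper coloring of $G[P]$; an $m$-coloring of $G$ is a proper coloring using at most $m$ colors; $d$ is extended by a coloring $f$ of $G$ if $f(v)=d(v)$ for all $v\in P$. -}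

module Defs where

open import Data.Empty using (⊥-elim)
open import Data.Fin using (Fin; zero; suc) renaming (_<_ to _<ᶠ_)
open import Data.Fin.Properties using (any?; all?) renaming (_≟_ to _≟ᶠ_; _<?_ to _<ᶠ?_)
open import Data.Fin.Subset using (Subset; _∈_)
open import Data.Fin.Subset.Properties using (_∈?_)
open import Data.List using (List; allFin; cartesianProduct; filter; length)
open import Data.Nat using (ℕ; zero; suc; _≤_; z≤n; s≤s)
open import Data.Nat.Properties using (≤-trans; anyUpTo?)
open import Data.Product using (∃; _×_; _,_; proj₁; proj₂)
open import Function using (id; _∘_)
open import Relation.Binary.Definitions using (Symmetric) renaming (Decidable to Decidable₂)
open import Relation.Binary.PropositionalEquality using (_≡_; _≢_; _≗_; refl; sym; trans; subst)
open import Relation.Nullary using (¬_; Dec; yes; no; map′; ¬?; _×-dec_; _→-dec_)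
open import Relation.Unary using (Pred; Decidable)
open import Level using (0ℓ)

Least : Pred ℕ 0ℓ → Pred ℕ 0ℓ
Least Q c = Q c × (∀ m → Q m → c ≤ m)

least : ∀ {Q : Pred ℕ 0ℓ} → Decidable Q → ∀ m → Q m → ∃ (Least Q)
least Q? zero    q = zero , q , λ _ _ → z≤n
least {Q} Q? (suc m) q with Q? zero
... | yes q₀ = zero , q₀ , λ _ _ → z≤n
... | no ¬q₀ with least {Q ∘ suc} (Q? ∘ suc) m q
...   | c , qc , min = suc c , qc , λ { zero q₀ → ⊥-elim (¬q₀ q₀) ; (suc j) qj → s≤s (min j qj) }

-- Finite simple graphs; the vertex set is Fin n.
record Graph (n : ℕ) : Set₁ where
  field
    Adj        : Fin n → Fin n → Set
    adj?       : Decidable₂ Adj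
    adj-sym    : Symmetric Adj
    adj-irrefl : ∀ {x} → ¬ Adj x x

open Graph public

-- The palette [m] is Fin m.
IsProper : ∀ {n m} → Graph n → (Fin n → Fin m) → Set
IsProper G f = ∀ x y → Adj G x y → f x ≢ f y

record Coloring {n : ℕ} (G : Graph n) (m : ℕ) : Set where
  field
    color  : Fin n → Fin m
    proper : IsProper G color

open Coloring public

record Precoloring {n : ℕ} (G : Graph n) (P : Subset n) (m : ℕ) : Set where
  field
    precolor  : ∀ v → v ∈ P → Fin m
    preproper : ∀ x y (x∈P : x ∈ P) (y∈P : y ∈ P) → Adj G x y → precolor x x∈P ≢ precolor y y∈P

open Precoloring public

_Extends_ : ∀ {n m} {G : Graph n} {P : Subset n} → Coloring G m → Precoloring G P m → Set
_Extends_ {P = P} f d = ∀ v (v∈P : v ∈ P) → color f v ≡ precolor d v v∈P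

IsChromaticNumber : ∀ {n} → Graph n → ℕ → Set
IsChromaticNumber G = Least (Coloring G)

private
  nil : ∀ {m} → Fin zero → Fin m
  nil ()

  cons : ∀ {n m} → Fin m → (Fin n → Fin m) → Fin (suc n) → Fin m
  cons c f zero    = c
  cons c f (suc i) = f i

  anyFun? : ∀ n {m} {Q : (Fin n → Fin m) → Set} →
            (∀ {f g} → f ≗ g → Q f → Q g) → Decidable Q → Dec (∃ Q)
  anyFun? zero resp Q? =
    map′ (λ q → nil , q) (λ { (f , q) → resp (λ ()) q }) (Q? nil)
  anyFun? (suc n) {Q = Q} resp Q? =
    map′ (λ { (c , f , q) → cons c f , q })
         (λ { (f , q) → f zero , f ∘ suc , resp (λ { zero → refl ; (suc i) → refl }) q })
         (any? (λ c → anyFun? n {Q = Q ∘ cons c}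
                        (λ e → resp (λ { zero → refl ; (suc i) → e i }))
                        (Q? ∘ cons c)))

coloring? : ∀ {n} (G : Graph n) → Decidable (Coloring G)
coloring? {n} G m =
  map′ (λ { (f , p) → record { color = f ; proper = p } })
       (λ c → color c , proper c)
       (anyFun? n {Q = IsProper G}
         (λ e p x y a q → p x y a (trans (e x) (trans q (sym (e y)))))
         (λ f → all? λ x → all? λ y → adj? G x y →-dec ¬? (f x ≟ᶠ f y)))

chromaticNumber : ∀ {n} (G : Graph n) → ∃ (IsChromaticNumber G)
chromaticNumber {n} G = least (coloring? G) n
  (record { color = id ; proper = λ x y a x≡y → adj-irrefl G (subst (Adj G x) (sym x≡y) a) })

χ : ∀ {n} → Graph n → ℕ
χ G = proj₁ (chromaticNumber G)

Walk : ∀ {n} → Graph n → Fin n → Fin n → ℕ → Set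
Walk G x y zero    = x ≡ y
Walk G x y (suc l) = ∃ λ z → Adj G x z × Walk G z y l

walk? : ∀ {n} (G : Graph n) x y → Decidable (Walk G x y)
walk? G x y zero    = x ≟ᶠ y
walk? G x y (suc l) = any? λ z → adj? G x z ×-dec walk? G z y l

IsDistance : ∀ {n} → Graph n → Fin n → Fin n → ℕ → Set
IsDistance G x y = Least (Walk G x y)

-- d_G(x,y) ≤ k.  Vertices in different components have no distance (it is
-- infinite), so the relation fails for them.
Distance≤ : ∀ {n} → Graph n → ℕ → Fin n → Fin n → Set
Distance≤ G k x y = ∃ λ l → IsDistance G x y l × l ≤ k

distance≤? : ∀ {n} (G : Graph n) k → Decidable₂ (Distance≤ G k)
distance≤? G k x y =
  map′ (λ { (l , s≤s l≤k , w) →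
            let (c , isD) = least (walk? G x y) l w
            in c , isD , ≤-trans (proj₂ isD l w) l≤k })
       (λ { (l , isD , l≤k) → l , s≤s l≤k , proj₁ isD })
       (anyUpTo? (walk? G x y) (suc k))

-- The unordered pair {x,y} with x ≢ y is represented once, by its
-- increasingly ordered version.
InD : ∀ {n} → Graph n → Subset n → ℕ → Fin n × Fin n → Set
InD G P k (x , y) = x <ᶠ y × x ∈ P × y ∈ P × Distance≤ G k x y

inD? : ∀ {n} (G : Graph n) (P : Subset n) k → Decidable (InD G P k)
inD? G P k (x , y) = x <ᶠ? y ×-dec x ∈? P ×-dec y ∈? P ×-dec distance≤? G k x y

𝒟 : ∀ {n} → Graph n → Subset n → ℕ → List (Fin n × Fin n)
𝒟 {n} G P k = filter (inD? G P k) (cartesianProduct (allFin n) (allFin n))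

-- 𝒟 lists every pair exactly once, so its length is the cardinality.
∣𝒟∣ : ∀ {n} → Graph n → Subset n → ℕ → ℕ
∣𝒟∣ G P k = length (𝒟 G P k)

{-# OPTIONS --safe #-}
module Submission where

-- Weight each pair of colors {a, b} by the number of pairs in 𝒟_G(P,2) colored a and b.
-- Fix a proper coloring of G with r classes and give the classes disjoint palettes: a vertex
-- outside P can be colored from its palette unless its neighbors in P carry all colors of the
-- palette, which is impossible when the palette contains a pair of weight 0.
--
-- By a bound of Erdős–Gallai type on graphs without large matchings (the edges being the pairs
-- of weight 0), the first threshold yields r − 1 disjoint pairs of weight 0, leaving a set S of
-- k − r + 2 colors for one last class.  If S fails for each choice of that class, every pair in
-- S has weight at least 2.  Exchanging a color of a matched pair {a, b} with a color of S then
-- shows that {a, b} has weight at least 2|S| towards S.  In total the weight is at least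
-- (k − r + 2)(k + r − 1), contradicting the second threshold.

open import Defs
import Algebra.Solver.CommutativeMonoid as CMSolver
open import Data.Empty using (⊥-elim)
open import Data.Fin using (Fin; zero; suc; inject≤; fromℕ)
open import Data.Fin.Permutation.Components using (transpose; transpose-inverse)
open import Data.Fin.Properties using (any?; ∀-cons; inject≤-injective; <-cmp) renaming (_≟_ to _≟ᶠ_)
open import Data.Fin.Subset using (Subset) renaming (_∈_ to _∈ˢ_; _∉_ to _∉ˢ_)
open import Data.Fin.Subset.Properties using () renaming (_∈?_ to _∈ˢ?_)
open import Data.List using (List; []; _∷_; _++_; [_]; length; map; allFin)
open import Data.List.Membership.Propositional using (_∈_; find)
open import Data.List.Membership.Propositional.Properties using (∈-∃++; ∈-allFin; ∈-cartesianProduct⁺; ∈-filter⁺)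
open import Data.List.Properties using (length-++; ++-identityʳ; length-tabulate)
open import Data.List.Relation.Binary.Permutation.Propositional using (_↭_; prep; swap; ↭-refl; ↭-sym; ↭-trans; ↭⇒↭ₛ)
open import Data.List.Relation.Binary.Permutation.Propositional.Properties using (↭-length; All-resp-↭; drop-∷; ∈-resp-↭; shift; ++⁺ˡ; ++⁺ʳ; ++-comm; ++-commutativeMonoid) renaming (map⁺ to map⁺-↭)
import Data.List.Relation.Binary.Permutation.Setoid.Properties as PermSetoid
open import Data.List.Relation.Unary.All as All using (All; []; _∷_; all?)
open import Data.List.Relation.Unary.All.Properties using (¬Any⇒All¬; ¬All⇒Any¬)
open import Data.List.Relation.Unary.AllPairs using (AllPairs; []; _∷_)
open import Data.List.Relation.Unary.Any as Any using (here; there)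
open import Data.List.Relation.Unary.Unique.Propositional using (Unique)
open import Data.List.Relation.Unary.Unique.Propositional.Properties using (allFin⁺)
open import Data.Nat using (ℕ; zero; suc; _+_; _*_; _∸_; _/_; _⊓_; _≤_; _<_; _>_; z≤n; s≤s)
open import Data.Nat.DivMod using (m/n*n≤m)
open import Data.Nat.ListAction using (sum)
open import Data.Nat.ListAction.Properties using (sum-↭)
open import Data.Nat.Properties hiding (_≟_; <-cmp)
open import Data.Nat.Tactic.RingSolver using (solve-∀)
open import Data.Product using (∃; ∃₂; _×_; _,_; proj₁; proj₂)
open import Data.Sum as Sum using (_⊎_; inj₁; inj₂; [_,_]′) renaming (swap to ⊎-swap)
open import Data.Vec.Properties.WithK using ([]=-irrelevant)
open import Function using (_∘_; id)
open import Relation.Binary.Definitions using (tri<; tri≈; tri>)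
open import Relation.Binary.PropositionalEquality using (_≡_; _≢_; refl; sym; trans; cong; cong₂; subst; setoid)
open import Relation.Nullary using (¬_; Dec; yes; no; _×-dec_; _⊎-dec_; contradiction)
open import Relation.Nullary.Decidable using (dec-true)

private variable A B V X : Set

-- Lists up to permutation, and sums over them

∈⇒↭ : {x : V} {xs : List V} → x ∈ xs → ∃ λ ys → xs ↭ x ∷ ys
∈⇒↭ x∈xs with ys , zs , refl ← ∈-∃++ x∈xs = ys ++ zs , shift _ ys zs

-- Compares two ways of splitting an element off the same list: either the two elements agree, or
-- both can be split off at once.
↭-∷-cases : {x y : V} {xs ys : List V} → x ∷ xs ↭ y ∷ ys →
            (x ≡ y × xs ↭ ys) ⊎ (∃ λ zs → ys ↭ x ∷ zs × xs ↭ y ∷ zs)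
↭-∷-cases p with ∈-resp-↭ p (here refl)
... | here refl = inj₁ (refl , drop-∷ p)
... | there x∈ys with zs , q ← ∈⇒↭ x∈ys =
  inj₂ (zs , q , drop-∷ (↭-trans p (↭-trans (prep _ q) (swap _ _ ↭-refl))))

-- The witness is moved to the front, so that a second search in the remainder finds an element at
-- another position.
all⊎extract : {P Q : X → Set} → (∀ x → P x ⊎ Q x) → ∀ xs →
              All P xs ⊎ ∃₂ λ x ys → xs ↭ x ∷ ys × Q x
all⊎extract P⊎Q [] = inj₁ []
all⊎extract P⊎Q (x ∷ xs) with P⊎Q x
... | inj₂ q = inj₂ (x , xs , ↭-refl , q)
... | inj₁ p with all⊎extract P⊎Q xs
...   | inj₁ ps = inj₁ (p ∷ ps)
...   | inj₂ (y , ys , r , q) = inj₂ (y , x ∷ ys , ↭-trans (prep x r) (swap x y ↭-refl) , q)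

allPairs⊎extract : {P Q : X → X → Set} → (∀ x y → P x y ⊎ Q x y) → ∀ xs →
                   AllPairs P xs ⊎ ∃ λ x → ∃₂ λ y ys → xs ↭ x ∷ y ∷ ys × Q x y
allPairs⊎extract P⊎Q [] = inj₁ []
allPairs⊎extract P⊎Q (x ∷ xs) with all⊎extract (P⊎Q x) xs
... | inj₂ (y , ys , r , q) = inj₂ (x , y , ys , prep x r , q)
... | inj₁ ps with allPairs⊎extract P⊎Q xs
...   | inj₁ pss = inj₁ (ps ∷ pss)
...   | inj₂ (y , z , ys , r , q) = inj₂ (y , z , x ∷ ys ,
          ↭-trans (prep x r) (↭-trans (swap x y ↭-refl) (prep y (swap x z ↭-refl))) , q)

pos⊎zero : ∀ n → 1 ≤ n ⊎ n ≡ 0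
pos⊎zero zero    = inj₂ refl
pos⊎zero (suc n) = inj₁ (s≤s z≤n)

sum-map-↭ : (f : X → ℕ) {xs ys : List X} → xs ↭ ys → sum (map f xs) ≡ sum (map f ys)
sum-map-↭ f p = sum-↭ (map⁺-↭ f p)

sum-map-≥ : ∀ {κ} (f : X → ℕ) {xs} → All (λ x → κ ≤ f x) xs → length xs * κ ≤ sum (map f xs)
sum-map-≥ f []       = z≤n
sum-map-≥ f (p ∷ ps) = +-mono-≤ p (sum-map-≥ f ps)

sum-map-++-≥ : (f : X → ℕ) (xs ys : List X) → sum (map f ys) ≤ sum (map f (xs ++ ys))
sum-map-++-≥ f []       ys = ≤-refl
sum-map-++-≥ f (x ∷ xs) ys = ≤-trans (sum-map-++-≥ f xs ys) (m≤n+m _ (f x))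

flat : List (V × V) → List V
flat []            = []
flat ((a , b) ∷ M) = a ∷ b ∷ flat M

length-flat : (M : List (V × V)) → length (flat M) ≡ 2 * length M
length-flat []            = refl
length-flat ((a , b) ∷ M) = trans (cong (2 +_) (length-flat M)) (e (length M))
  where
  e : ∀ m → suc (suc (2 * m)) ≡ 2 * suc m
  e = solve-∀

flat-↭ : {M Q : List (V × V)} → M ↭ Q → flat M ↭ flat Q
flat-↭ _↭_.refl                        = ↭-refl
flat-↭ (prep (a , b) p)                = prep a (prep b (flat-↭ p))
flat-↭ (_↭_.trans p q)                 = ↭-trans (flat-↭ p) (flat-↭ q)
flat-↭ (swap {xs = M} {ys = Q} (a , b) (c , d) p) =
  ↭-trans (prep a (prep b (prep c (prep d (flat-↭ p)))))
          (++⁺ʳ (flat Q) (++-comm (a ∷ b ∷ []) (c ∷ d ∷ [])))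

private
  interchange : ∀ a b c d → a + b + (c + d) ≡ a + c + (b + d)
  interchange = solve-∀

-- Total weight of a list and lower bounds for it

totalWeight : (V → V → ℕ) → List V → ℕ
totalWeight w []       = 0
totalWeight w (x ∷ xs) = sum (map (w x) xs) + totalWeight w xs

Zero : (V → V → ℕ) → V × V → Set
Zero w (a , b) = w a b ≡ 0

-- Pairs of weight zero are the edges of the graph in which matchings are sought.
module _ (w : V → V → ℕ) (w-sym : ∀ a b → w a b ≡ w b a) where

  private
    W : List V → ℕ
    W = totalWeight w

    row : V → List V → ℕ
    row x xs = sum (map (w x) xs)

  open CMSolver (++-commutativeMonoid {A = V}) using (solve; _⊜_; _⊕_)

  totalWeight-↭ : ∀ {xs ys} → xs ↭ ys → W xs ≡ W ys
  totalWeight-↭ _↭_.refl        = refl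
  totalWeight-↭ (prep x p)      = cong₂ _+_ (sum-map-↭ (w x) p) (totalWeight-↭ p)
  totalWeight-↭ (_↭_.trans p q) = trans (totalWeight-↭ p) (totalWeight-↭ q)
  totalWeight-↭ (swap {xs = xs} {ys = ys} x y p)
    rewrite w-sym x y | sum-map-↭ (w x) p | sum-map-↭ (w y) p | totalWeight-↭ p =
    interchange (w y x) (row x ys) (row y ys) (W ys)

  totalWeight-++-≥ : ∀ xs ys → W ys ≤ W (xs ++ ys)
  totalWeight-++-≥ []       ys = ≤-refl
  totalWeight-++-≥ (x ∷ xs) ys = ≤-trans (totalWeight-++-≥ xs ys) (m≤n+m _ _)

  -- Only the weight between the pairs and `S` and the weight inside `S` are kept; the weight among
  -- the paired elements is dropped.
  totalWeight-flat-≥ : ∀ {κ} Q S → All (λ (a , b) → κ ≤ row a S + row b S) Q →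
                       length Q * κ + W S ≤ W (flat Q ++ S)
  totalWeight-flat-≥ []            S []       = ≤-refl
  totalWeight-flat-≥ {κ} ((a , b) ∷ Q) S (p ∷ ps) = begin
    κ + length Q * κ + W S
      ≡⟨ +-assoc κ _ _ ⟩
    κ + (length Q * κ + W S)
      ≤⟨ +-mono-≤ p (totalWeight-flat-≥ Q S ps) ⟩
    row a S + row b S + W (flat Q ++ S)
      ≤⟨ +-monoˡ-≤ _ (+-mono-≤ (sum-map-++-≥ (w a) (b ∷ flat Q) S) (sum-map-++-≥ (w b) (flat Q) S)) ⟩
    row a (b ∷ flat Q ++ S) + row b (flat Q ++ S) + W (flat Q ++ S)
      ≡⟨ +-assoc (row a (b ∷ flat Q ++ S)) _ _ ⟩
    row a (b ∷ flat Q ++ S) + (row b (flat Q ++ S) + W (flat Q ++ S))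
      ∎
    where open ≤-Reasoning

  -- A list of length s has s(s - 1)/2 pairs; doubling the total avoids the division.
  allPairs⇒totalWeight-≥ : ∀ {κ S} → AllPairs (λ a b → κ ≤ w a b) S →
                           length S * (length S ∸ 1) * κ ≤ 2 * W S
  allPairs⇒totalWeight-≥ []                      = z≤n
  allPairs⇒totalWeight-≥ {κ} {x ∷ S} (p ∷ ps) = begin
    suc s * s * κ                   ≤⟨ *-monoˡ-≤ κ (e₁ s) ⟩
    (2 * s + s * (s ∸ 1)) * κ       ≡⟨ e₂ s (s * (s ∸ 1)) κ ⟩
    2 * (s * κ) + s * (s ∸ 1) * κ   ≤⟨ +-mono-≤ (*-monoʳ-≤ 2 (sum-map-≥ (w x) p)) (allPairs⇒totalWeight-≥ ps) ⟩
    2 * row x S + 2 * W S           ≡⟨ *-distribˡ-+ 2 (row x S) (W S) ⟨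
    2 * W (x ∷ S)                   ∎
    where
    open ≤-Reasoning
    s : ℕ
    s = length S
    e₀ : ∀ t → suc (suc t) * suc t ≡ 2 * suc t + suc t * t
    e₀ = solve-∀
    e₁ : ∀ s → suc s * s ≤ 2 * s + s * (s ∸ 1)
    e₁ zero    = z≤n
    e₁ (suc t) = ≤-reflexive (e₀ t)
    e₂ : ∀ s t κ → (2 * s + t) * κ ≡ 2 * (s * κ) + t * κ
    e₂ = solve-∀

  -- Matchings of zero pairs and the bound of Erdős-Gallai type

  record Matching (m : ℕ) (L : List V) : Set where
    constructor matching
    field
      {pairs}   : List (V × V)
      {rest}    : List V
      partition : flat pairs ++ rest ↭ L
      size      : length pairs ≡ m
      zeros     : All (Zero w) pairs

  Matching-resp-↭ : ∀ {m L L′} → L ↭ L′ → Matching m L → Matching m L′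
  Matching-resp-↭ p (matching q l z) = matching (↭-trans q p) l z

  Matching-∷ : ∀ {m L a b} → w a b ≡ 0 → Matching m L → Matching (suc m) (a ∷ b ∷ L)
  Matching-∷ z (matching q l zs) = matching (prep _ (prep _ q)) (cong suc l) (z ∷ zs)

  Matching-++ : ∀ {m L} Q → All (Zero w) Q → Matching m L → Matching (length Q + m) (flat Q ++ L)
  Matching-++ []      []       μ = μ
  Matching-++ (_ ∷ Q) (z ∷ zs) μ = Matching-∷ z (Matching-++ Q zs μ)

  -- A can be matched into S with zero pairs while avoiding any two prescribed elements of S;
  -- hence a zero pair inside S enlarges the matching.
  Flexible : List V → List V → Set
  Flexible A S = ∀ {u v R} → S ↭ u ∷ v ∷ R → Matching (length A) (A ++ R)

  TwoZeros : V → List V → Set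
  TwoZeros c S = ∃ λ s → ∃₂ λ t R → S ↭ s ∷ t ∷ R × w c s ≡ 0 × w c t ≡ 0

  -- Removing `v` leaves at least one of the two zeros of `c`. That one is matched with `c`, and the
  -- flexibility of `A` is spent on avoiding it together with `v`.
  Flexible-∷-avoid : ∀ {A S c v R} → TwoZeros c S → Flexible A S → S ↭ v ∷ R →
                     Matching (suc (length A)) (c ∷ A ++ R)
  Flexible-∷-avoid {A} {c = c} {v} (s , t , R₀ , S↭ , cs≡0 , ct≡0) flex q
    with ↭-∷-cases (↭-trans (↭-sym S↭) q)
  ... | inj₁ (refl , r) =
    Matching-resp-↭ (prep c (↭-trans (↭-sym (shift t A R₀)) (++⁺ˡ A r)))
      (Matching-∷ ct≡0 (flex S↭))
  ... | inj₂ (R₁ , r , _) =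
    Matching-resp-↭ (prep c (↭-trans (↭-sym (shift s A R₁)) (++⁺ˡ A (↭-sym r))))
      (Matching-∷ cs≡0 (flex (↭-trans q (prep v r))))

  -- If `d` is one of the two prescribed elements, only one of them lies in `S` and the preceding
  -- lemma applies. Otherwise `c` is matched with `d`, and `A` avoids both inside `S`.
  Flexible-∷ : ∀ {A S c d} → w c d ≡ 0 → TwoZeros c S → Flexible A S → Flexible (c ∷ A) (d ∷ S)
  Flexible-∷ {A} {c = c} {d} cd≡0 two flex {u} p with ↭-∷-cases p
  ... | inj₁ (refl , q) = Flexible-∷-avoid two flex q
  ... | inj₂ (R₁ , q , q′) with ↭-∷-cases q
  ...   | inj₁ (refl , r) = Flexible-∷-avoid two flex (↭-trans q′ (prep u (↭-sym r)))
  ...   | inj₂ (R₂ , r , r′) =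
    Matching-resp-↭ (prep c (↭-trans (↭-sym (shift d A R₂)) (++⁺ˡ A (↭-sym r′))))
      (Matching-∷ cd≡0 (flex (↭-trans q′ (prep u r))))

  -- The structure left when a matching with m pairs cannot be enlarged: p elements set aside,
  -- an independent set with σ elements, and q pairs with at most two zeros each towards that set.
  Deficient : ℕ → List V → Set
  Deficient m L = ∃ λ p → ∃₂ λ q σ → p + q ≡ m × p + (σ + 2 * q) ≡ length L ×
                  (σ ∸ 1) * (σ + 4 * q) ≤ 2 * W L

  row-≥⊎twoZeros : ∀ c S → length S ∸ 1 ≤ row c S ⊎ TwoZeros c S
  row-≥⊎twoZeros c S with all⊎extract (pos⊎zero ∘ w c) S
  ... | inj₁ ps = inj₁ (≤-trans (m∸n≤m (length S) 1)
          (≤-trans (≤-reflexive (sym (*-identityʳ _))) (sum-map-≥ (w c) ps)))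
  ... | inj₂ (s , R , S↭ , cs≡0) with all⊎extract (pos⊎zero ∘ w c) R
  ...   | inj₂ (t , R′ , R↭ , ct≡0) = inj₂ (s , t , R′ , ↭-trans S↭ (prep s R↭) , cs≡0 , ct≡0)
  ...   | inj₁ ps = inj₁ (begin
    length S ∸ 1    ≡⟨ cong (_∸ 1) (↭-length S↭) ⟩
    length R        ≡⟨ *-identityʳ _ ⟨
    length R * 1    ≤⟨ sum-map-≥ (w c) ps ⟩
    row c R         ≤⟨ m≤n+m _ (w c s) ⟩
    row c (s ∷ R)   ≡⟨ sum-map-↭ (w c) S↭ ⟨
    row c S         ∎)
    where open ≤-Reasoning

  pairRows-≥⊎twoZeros : ∀ S ((c , d) : V × V) → 2 * (length S ∸ 1) ≤ row c S + row d S ⊎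
                        (TwoZeros c S ⊎ TwoZeros d S)
  pairRows-≥⊎twoZeros S (c , d) with row-≥⊎twoZeros c S | row-≥⊎twoZeros d S
  ... | inj₂ two | _        = inj₂ (inj₁ two)
  ... | inj₁ _   | inj₂ two = inj₂ (inj₂ two)
  ... | inj₁ p   | inj₁ q   = inj₁ (+-mono-≤ p (≤-trans (≤-reflexive (+-identityʳ _)) q))

  -- A pair (c, d) of Q such that c has two zeros in S is dissolved: c goes to A and d to S.
  augment⊎bound : ∀ {n m L} A S Q → length Q ≡ n → length A + length Q ≡ m →
                  A ++ flat Q ++ S ↭ L → Flexible A S → All (Zero w) Q →
                  Matching (suc m) L ⊎ Deficient m L
  augment⊎bound A S Q l lm L↭ flex zQ with all⊎extract (pairRows-≥⊎twoZeros S) Q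
  augment⊎bound {zero}  A S [] l lm L↭ flex zQ | inj₂ (_ , Q′ , Q↭ , _) with () ← ↭-length Q↭
  augment⊎bound {suc n} {m} {L} A S Q l lm L↭ flex zQ | inj₂ ((c , d) , Q′ , Q↭ , two)
    with cd≡0 ∷ zQ′ ← All-resp-↭ Q↭ zQ = [ (λ cs → move cs cd≡0 (flat-↭ Q↭))
                                         , (λ ds → move ds (trans (w-sym d c) cd≡0)
                                                        (↭-trans (flat-↭ Q↭) (swap c d ↭-refl))) ]′ two
    where
    move : ∀ {x y} → TwoZeros x S → w x y ≡ 0 → flat Q ↭ x ∷ y ∷ flat Q′ →
           Matching (suc m) L ⊎ Deficient m L
    move {x} {y} xs xy≡0 fl =
      -- The recursion is on the number of pairs left in `Q`; the sum `length A + length Q` remains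
      -- `m`.
      augment⊎bound (x ∷ A) (y ∷ S) Q′ (suc-injective (trans (sym (↭-length Q↭)) l))
        (trans (sym (+-suc _ _)) (trans (cong (length A +_) (sym (↭-length Q↭))) lm))
        (↭-trans (↭-sym (↭-trans (++⁺ˡ A (++⁺ʳ S fl))
          (solve 5 (λ a x y q s → (a ⊕ ((x ⊕ (y ⊕ q)) ⊕ s)) ⊜ (x ⊕ (a ⊕ (q ⊕ (y ⊕ s))))) ↭-refl
            A [ x ] [ y ] (flat Q′) S))) L↭)
        (Flexible-∷ xy≡0 xs flex) zQ′
  augment⊎bound {m = m} {L} A S Q l lm L↭ flex zQ | inj₁ rows
    with allPairs⊎extract (λ a b → pos⊎zero (w a b)) S
  -- The pairs of `Q`, the pair (u, v), and a matching of `A` into `S` without u and v are `m + 1`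
  -- disjoint zero pairs.
  ... | inj₂ (u , v , R , S↭ , uv≡0) =
    inj₁ (subst (λ i → Matching i L) (trans (+-suc _ _) (cong suc (trans (+-comm (length Q) _) lm)))
      (Matching-resp-↭ perm (Matching-++ Q zQ (Matching-∷ uv≡0 (flex S↭)))))
    where
    perm : flat Q ++ u ∷ v ∷ A ++ R ↭ L
    perm = ↭-trans (solve 5 (λ q u v a r → (q ⊕ (u ⊕ (v ⊕ (a ⊕ r)))) ⊜ (a ⊕ (q ⊕ (u ⊕ (v ⊕ r))))) ↭-refl
                     (flat Q) [ u ] [ v ] A R)
                   (↭-trans (++⁺ˡ A (++⁺ˡ (flat Q) (↭-sym S↭))) L↭)
  ... | inj₁ pairs = inj₂ (length A , length Q , length S , lm , lengths , bound)
    where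
    lengths : length A + (length S + 2 * length Q) ≡ length L
    lengths = trans (sym (trans (length-++ A) (cong (length A +_) (trans (length-++ (flat Q))
                (trans (cong (_+ length S) (length-flat Q)) (+-comm (2 * length Q) _))))))
                (↭-length L↭)
    e : ∀ q t s → t * (s + 4 * q) ≡ 2 * (q * (2 * t)) + s * t * 1
    e = solve-∀
    open ≤-Reasoning
    -- With σ and q the lengths of `S` and `Q`: the pairs of `Q` send weight at least q · 2(σ - 1)
    -- to `S`, and `S` contains at least σ(σ - 1)/2. Nothing is claimed for `A`.
    bound : (length S ∸ 1) * (length S + 4 * length Q) ≤ 2 * W L
    bound = begin
      (length S ∸ 1) * (length S + 4 * length Q)
        ≡⟨ e (length Q) (length S ∸ 1) (length S) ⟩
      2 * (length Q * (2 * (length S ∸ 1))) + length S * (length S ∸ 1) * 1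
        ≤⟨ +-monoʳ-≤ _ (allPairs⇒totalWeight-≥ pairs) ⟩
      2 * (length Q * (2 * (length S ∸ 1))) + 2 * W S
        ≡⟨ *-distribˡ-+ 2 (length Q * (2 * (length S ∸ 1))) (W S) ⟨
      2 * (length Q * (2 * (length S ∸ 1)) + W S)
        ≤⟨ *-monoʳ-≤ 2 (totalWeight-flat-≥ Q S rows) ⟩
      2 * W (flat Q ++ S)
        ≤⟨ *-monoʳ-≤ 2 (totalWeight-++-≥ A (flat Q ++ S)) ⟩
      2 * W (A ++ flat Q ++ S)
        ≡⟨ cong (2 *_) (totalWeight-↭ L↭) ⟩
      2 * W L ∎

  matching⊎deficient : ∀ t L → Matching t L ⊎ ∃ λ m → m < t × Deficient m L
  matching⊎deficient zero    L = inj₁ (matching {pairs = []} ↭-refl refl [])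
  matching⊎deficient (suc t) L with matching⊎deficient t L
  ... | inj₂ (m , m<t , δ) = inj₂ (m , m<n⇒m<1+n m<t , δ)
  ... | inj₁ (matching {M} {S} p l z)
    -- At the start nothing is set aside: `A` is empty, `S` is the unmatched part, and the empty
    -- matching shows flexibility.
    with augment⊎bound [] S M refl l p (λ _ → matching {pairs = []} ↭-refl refl []) z
  ...   | inj₁ μ = inj₁ μ
  ...   | inj₂ δ = inj₂ (t , ≤-refl , δ)

  -- Exchanging matched and unmatched elements

  module _ {E : Set} {m : ℕ} {L : List V}
    -- `E` will be the existence of an extension. All matchings with `m` pairs are covered, so the
    -- hypothesis still applies after an exchange.
    (heavy : ∀ {M S} → flat M ++ S ↭ L → length M ≡ m → All (Zero w) M →
             E ⊎ AllPairs (λ a b → 2 ≤ w a b) S) where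

    private
      -- Replacing the pair (a, b) by (a, s) leaves b unmatched next to `R`, so `heavy` now speaks
      -- of the weights of b.
      exchange : ∀ {a b s S R M} → a ∷ b ∷ flat M ++ S ↭ L → suc (length M) ≡ m → All (Zero w) M →
                 S ↭ s ∷ R → w a s ≡ 0 → E ⊎ All (λ t → 2 ≤ w b t) R
      exchange {a} {b} {s} {S} {R} {M} p l z S↭ as≡0 with heavy {(a , s) ∷ M} {b ∷ R} perm l (as≡0 ∷ z)
        where
        perm : a ∷ s ∷ flat M ++ b ∷ R ↭ L
        perm = ↭-trans (solve 5 (λ a s m b r → (a ⊕ (s ⊕ (m ⊕ (b ⊕ r)))) ⊜ (a ⊕ (b ⊕ (m ⊕ (s ⊕ r))))) ↭-refl
                         [ a ] [ s ] (flat M) [ b ] R)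
                       (↭-trans (prep a (prep b (++⁺ˡ (flat M) (↭-sym S↭)))) p)
      ... | inj₁ ε           = inj₁ ε
      ... | inj₂ (ws ∷ _)    = inj₂ ws

      -- The cases are the number of zeros of a in `S`. With none, a alone contributes |S|. With a
      -- single zero s, a contributes 1 and, by exchange with s, b contributes 2 for each other
      -- element: 3(|S| - 1) ≥ 2|S| since |S| ≥ 3. With two zeros s and t, the exchange with s
      -- bounds b towards all of `S` except s, and the exchange with t covers s.
      row-≥⊎rows-≥ : ∀ {a b S M} → 3 ≤ length S → a ∷ b ∷ flat M ++ S ↭ L → suc (length M) ≡ m →
                     All (Zero w) M → E ⊎ (length S ≤ row a S ⊎ 2 * length S ≤ row a S + row b S)
      row-≥⊎rows-≥ {a} {b} {S} 3≤S p l z with all⊎extract (pos⊎zero ∘ w a) S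
      ... | inj₁ ps = inj₂ (inj₁ (≤-trans (≤-reflexive (sym (*-identityʳ _))) (sum-map-≥ (w a) ps)))
      ... | inj₂ (s , R , S↭ , as≡0) with exchange p l z S↭ as≡0
      ...   | inj₁ ε = inj₁ ε
      ...   | inj₂ bR with all⊎extract (pos⊎zero ∘ w a) R
      ...     | inj₁ aR = inj₂ (inj₂ (begin
        2 * length S          ≡⟨ cong (2 *_) (↭-length S↭) ⟩
        2 * suc (length R)    ≡⟨ e₁ (length R) ⟩
        2 + 2 * length R      ≤⟨ +-monoˡ-≤ _ (≤-pred (subst (3 ≤_) (↭-length S↭) 3≤S)) ⟩
        length R + 2 * length R      ≡⟨ e₂ (length R) ⟩
        length R * 1 + length R * 2  ≤⟨ +-mono-≤ (sum-map-≥ (w a) aR) (sum-map-≥ (w b) bR) ⟩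
        row a R + row b R     ≤⟨ +-mono-≤ (m≤n+m _ (w a s)) (m≤n+m _ (w b s)) ⟩
        row a (s ∷ R) + row b (s ∷ R) ≡⟨ cong₂ _+_ (sum-map-↭ (w a) S↭) (sum-map-↭ (w b) S↭) ⟨
        row a S + row b S     ∎))
        where
        open ≤-Reasoning
        e₁ : ∀ n → 2 * suc n ≡ 2 + 2 * n
        e₁ = solve-∀
        e₂ : ∀ n → n + 2 * n ≡ n * 1 + n * 2
        e₂ = solve-∀
      ...     | inj₂ (t , R′ , R↭ , at≡0)
        with exchange p l z (↭-trans S↭ (↭-trans (prep s R↭) (swap s t ↭-refl))) at≡0
      ...       | inj₁ ε = inj₁ ε
      ...       | inj₂ (bs ∷ _) = inj₂ (inj₂ (begin
        2 * length S             ≡⟨ *-comm 2 (length S) ⟩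
        length S * 2             ≡⟨ cong (_* 2) (↭-length S↭) ⟩
        length (s ∷ R) * 2       ≤⟨ sum-map-≥ (w b) (bs ∷ bR) ⟩
        row b (s ∷ R)            ≡⟨ sum-map-↭ (w b) S↭ ⟨
        row b S                  ≤⟨ m≤n+m _ (row a S) ⟩
        row a S + row b S        ∎))
        where open ≤-Reasoning

      -- The preceding lemma is used for (a, b) and for (b, a); if both give only |S| for one row,
      -- the two rows add up to 2|S|.
      rows-≥ : ∀ {a b S M} → 3 ≤ length S → a ∷ b ∷ flat M ++ S ↭ L → suc (length M) ≡ m →
               All (Zero w) M → E ⊎ 2 * length S ≤ row a S + row b S
      rows-≥ {a} {b} {S} 3≤S p l z
        with row-≥⊎rows-≥ 3≤S p l z | row-≥⊎rows-≥ 3≤S (↭-trans (swap b a ↭-refl) p) l z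
      ... | inj₁ ε        | _             = inj₁ ε
      ... | inj₂ (inj₂ q) | _             = inj₂ q
      ... | inj₂ (inj₁ _) | inj₁ ε        = inj₁ ε
      ... | inj₂ (inj₁ _) | inj₂ (inj₂ q) = inj₂ (≤-trans q (≤-reflexive (+-comm (row b S) _)))
      ... | inj₂ (inj₁ q) | inj₂ (inj₁ r) =
        inj₂ (+-mono-≤ q (≤-trans (≤-reflexive (+-identityʳ _)) r))

      -- `M` collects the pairs already treated, because an exchange at one pair needs the whole
      -- matching.
      allRows-≥ : ∀ {S} → 3 ≤ length S → ∀ N M → flat (N ++ M) ++ S ↭ L → length (N ++ M) ≡ m →
                  All (Zero w) (N ++ M) → E ⊎ All (λ (a , b) → 2 * length S ≤ row a S + row b S) N
      allRows-≥ 3≤S []            M p l z        = inj₂ []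
      allRows-≥ {S} 3≤S ((a , b) ∷ N) M p l (ab ∷ z)
        with rows-≥ 3≤S p l z | allRows-≥ 3≤S N ((a , b) ∷ M)
               (↭-trans (++⁺ʳ S (flat-↭ (shift (a , b) N M))) p)
               (trans (↭-length (shift (a , b) N M)) l)
               (All-resp-↭ (↭-sym (shift (a , b) N M)) (ab ∷ z))
      ... | inj₁ ε | _       = inj₁ ε
      ... | inj₂ _ | inj₁ ε  = inj₁ ε
      ... | inj₂ q | inj₂ qs = inj₂ (q ∷ qs)

    -- Each of the `m` pairs sends weight at least 2σ to the σ unmatched elements, which carry at
    -- least 2 · σ(σ - 1)/2 among themselves. The size condition says σ ≥ 3.
    exchange-bound : Matching m L → 2 * m + 3 ≤ length L →
                     E ⊎ ∃ λ σ → 2 * m + σ ≡ length L × σ * (2 * m + (σ ∸ 1)) ≤ W L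
    exchange-bound (matching {M} {S} p refl z) 2m+3≤L = bound
      where
      σ : ℕ
      σ = length S
      lengths : 2 * m + σ ≡ length L
      lengths = trans (cong (_+ σ) (sym (length-flat M))) (trans (sym (length-++ (flat M))) (↭-length p))
      3≤σ : 3 ≤ σ
      3≤σ = +-cancelˡ-≤ (2 * m) 3 σ (≤-trans 2m+3≤L (≤-reflexive (sym lengths)))
      M≡M++[] : M ≡ M ++ []
      M≡M++[] = sym (++-identityʳ M)
      e : ∀ σ m t → σ * (2 * m + t) ≡ m * (2 * σ) + σ * t
      e = solve-∀
      open ≤-Reasoning
      bound : E ⊎ ∃ λ σ → 2 * m + σ ≡ length L × σ * (2 * m + (σ ∸ 1)) ≤ W L
      bound with heavy p refl z | allRows-≥ 3≤σ M [] (subst (λ X → flat X ++ S ↭ L) M≡M++[] p)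
                                    (cong length (sym M≡M++[])) (subst (All (Zero w)) M≡M++[] z)
      ... | inj₁ ε     | _         = inj₁ ε
      ... | inj₂ _     | inj₁ ε    = inj₁ ε
      ... | inj₂ pairs | inj₂ rows = inj₂ (σ , lengths , (begin
        σ * (2 * m + (σ ∸ 1))           ≡⟨ e σ m (σ ∸ 1) ⟩
        m * (2 * σ) + σ * (σ ∸ 1)       ≤⟨ +-monoʳ-≤ (m * (2 * σ)) (*-cancelʳ-≤ (σ * (σ ∸ 1)) (W S) 2
                                            (≤-trans (allPairs⇒totalWeight-≥ pairs)
                                                     (≤-reflexive (*-comm 2 (W S))))) ⟩
        m * (2 * σ) + W S               ≤⟨ totalWeight-flat-≥ M S rows ⟩
        W (flat M ++ S)                 ≡⟨ totalWeight-↭ p ⟩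
        W L                             ∎))

-- Weights of color pairs and their total

Unique-resp-↭ : {xs ys : List V} → xs ↭ ys → Unique xs → Unique ys
Unique-resp-↭ {V} p = PermSetoid.Unique-resp-↭ (setoid V) (↭⇒↭ₛ p)

AllPairs-++⁻ʳ : {R : V → V → Set} (xs : List V) {ys : List V} → AllPairs R (xs ++ ys) → AllPairs R ys
AllPairs-++⁻ʳ []       ps       = ps
AllPairs-++⁻ʳ (x ∷ xs) (_ ∷ ps) = AllPairs-++⁻ʳ xs ps

Unique⇒AllPairs : {R : V → V → Set} {xs : List V} →
                  (∀ {x y} → x ∈ xs → y ∈ xs → x ≢ y → R x y) → Unique xs → AllPairs R xs
Unique⇒AllPairs r []       = []
Unique⇒AllPairs r (p ∷ ps) =
  All.tabulate (λ y∈ → r (here refl) (there y∈) (All.lookup p y∈)) ∷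
  Unique⇒AllPairs (λ x∈ y∈ → r (there x∈) (there y∈)) ps

sum-map-∈ : (f : X → ℕ) {x : X} {xs : List X} → x ∈ xs → f x ≤ sum (map f xs)
sum-map-∈ f (here refl)      = m≤m+n _ _
sum-map-∈ f {xs = y ∷ _} (there x∈) = ≤-trans (sum-map-∈ f x∈) (m≤n+m _ (f y))

sum-map-∈₂ : (f : X → ℕ) {x y : X} {xs : List X} → x ≢ y → x ∈ xs → y ∈ xs →
             f x + f y ≤ sum (map f xs)
sum-map-∈₂ f x≢y (here refl) (here refl) = contradiction refl x≢y
sum-map-∈₂ f x≢y (here refl) (there y∈)  = +-monoʳ-≤ _ (sum-map-∈ f y∈)
sum-map-∈₂ f {x} {y} x≢y (there x∈) (here refl) =
  ≤-trans (≤-reflexive (+-comm (f x) (f y))) (+-monoʳ-≤ _ (sum-map-∈ f x∈))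
sum-map-∈₂ f {xs = z ∷ _} x≢y (there x∈) (there y∈) = ≤-trans (sum-map-∈₂ f x≢y x∈ y∈) (m≤n+m _ (f z))

sum-map-+ : (f g : X → ℕ) (xs : List X) →
            sum (map (λ x → f x + g x) xs) ≡ sum (map f xs) + sum (map g xs)
sum-map-+ f g []       = refl
sum-map-+ f g (x ∷ xs) rewrite sum-map-+ f g xs = interchange (f x) (g x) _ _

totalWeight-+ : (f g : V → V → ℕ) (L : List V) →
                totalWeight (λ a b → f a b + g a b) L ≡ totalWeight f L + totalWeight g L
totalWeight-+ f g []       = refl
totalWeight-+ f g (x ∷ xs) rewrite totalWeight-+ f g xs | sum-map-+ (f x) (g x) xs =
  interchange (sum (map (f x) xs)) (sum (map (g x) xs)) _ _

totalWeight-0 : (L : List V) → totalWeight (λ _ _ → 0) L ≡ 0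
totalWeight-0 []       = refl
totalWeight-0 (x ∷ xs) rewrite totalWeight-0 xs = trans (+-identityʳ _) (sum-map-0 xs)
  where
  sum-map-0 : ∀ ys → sum (map (λ _ → 0) ys) ≡ 0
  sum-map-0 []       = refl
  sum-map-0 (_ ∷ ys) = sum-map-0 ys

indicator : Dec A → ℕ
indicator (yes _) = 1
indicator (no  _) = 0

indicator-yes : (A? : Dec A) → A → indicator A? ≡ 1
indicator-yes (yes _) a = refl
indicator-yes (no ¬a) a = contradiction a ¬a

indicator-no : (A? : Dec A) → ¬ A → indicator A? ≡ 0
indicator-no (yes a) ¬a = contradiction a ¬a
indicator-no (no _)  ¬a = refl

indicator-cong : (A? : Dec A) (B? : Dec B) → (A → B) → (B → A) → indicator A? ≡ indicator B?
indicator-cong (yes a) B? f g = sym (indicator-yes B? (f a))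
indicator-cong (no ¬a) B? f g = sym (indicator-no B? (¬a ∘ g))

module _ {N : ℕ} where

  -- Equality of the unordered pairs {p, q} and {a, b}.
  Joins : Fin N → Fin N → Fin N → Fin N → Set
  Joins p q a b = (p ≡ a × q ≡ b) ⊎ (p ≡ b × q ≡ a)

  joins? : ∀ p q a b → Dec (Joins p q a b)
  joins? p q a b = (p ≟ᶠ a ×-dec q ≟ᶠ b) ⊎-dec (p ≟ᶠ b ×-dec q ≟ᶠ a)

  Joins-functional : ∀ {p q a b c} → Joins p q a b → Joins p q a c → b ≡ c
  Joins-functional (inj₁ (refl , refl)) (inj₁ (refl , refl)) = refl
  Joins-functional (inj₁ (refl , refl)) (inj₂ (refl , refl)) = refl
  Joins-functional (inj₂ (refl , refl)) (inj₁ (refl , refl)) = refl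
  Joins-functional (inj₂ (refl , refl)) (inj₂ (refl , refl)) = refl

  Joins-meet : ∀ {p q a b c d} → Joins p q a b → Joins p q c d → a ≡ c ⊎ a ≡ d
  Joins-meet (inj₁ (refl , refl)) (inj₁ (refl , refl)) = inj₁ refl
  Joins-meet (inj₁ (refl , refl)) (inj₂ (refl , refl)) = inj₂ refl
  Joins-meet (inj₂ (refl , refl)) (inj₁ (refl , refl)) = inj₂ refl
  Joins-meet (inj₂ (refl , refl)) (inj₂ (refl , refl)) = inj₁ refl

  module _ (p q : Fin N) where

    private
      ι : Fin N → Fin N → ℕ
      ι a b = indicator (joins? p q a b)

    row-none : ∀ {a xs} → All (¬_ ∘ Joins p q a) xs → sum (map (ι a) xs) ≡ 0
    row-none []       = refl
    row-none (n ∷ ns) = cong₂ _+_ (indicator-no (joins? p q _ _) n) (row-none ns)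

    totalWeight-none : ∀ {xs} → AllPairs (λ a b → ¬ Joins p q a b) xs → totalWeight ι xs ≡ 0
    totalWeight-none []       = refl
    totalWeight-none (n ∷ ns) = cong₂ _+_ (row-none n) (totalWeight-none ns)

    row-≤1 : ∀ a {xs} → Unique xs → sum (map (ι a) xs) ≤ 1
    row-≤1 a []                 = z≤n
    row-≤1 a {x ∷ xs} (x∉ ∷ u) with joins? p q a x
    ... | no _  = row-≤1 a u
    ... | yes j = ≤-reflexive (cong suc (row-none (All.map (λ x≢y j′ → x≢y (Joins-functional j j′)) x∉)))

    -- Once {p, q} = {x, y} is found in the row of x, any later pair equal to {p, q} would contain x
    -- again, against uniqueness.
    totalWeight-≤1 : ∀ {xs} → Unique xs → totalWeight ι xs ≤ 1
    totalWeight-≤1 []                 = z≤n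
    totalWeight-≤1 {x ∷ xs} (x∉ ∷ u) with Any.any? (joins? p q x) xs
    ... | no none = subst (λ n → n + totalWeight ι xs ≤ 1) (sym (row-none (¬Any⇒All¬ xs none)))
                      (totalWeight-≤1 u)
    ... | yes some with y , _ , j ← find some =
      subst (λ n → sum (map (ι x) xs) + n ≤ 1)
        (sym (totalWeight-none (Unique⇒AllPairs (λ a∈ b∈ _ j′ →
          [ All.lookup x∉ a∈ , All.lookup x∉ b∈ ]′ (Joins-meet j j′)) u)))
        (≤-trans (≤-reflexive (+-identityʳ _)) (row-≤1 x u))

  module _ (κ : X → Fin N) where

    joinsPair? : ∀ a b ((x , y) : X × X) → Dec (Joins (κ x) (κ y) a b)
    joinsPair? a b (x , y) = joins? (κ x) (κ y) a b

    pairWeight : List (X × X) → Fin N → Fin N → ℕ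
    pairWeight D a b = sum (map (indicator ∘ joinsPair? a b) D)

    pairWeight-sym : ∀ D a b → pairWeight D a b ≡ pairWeight D b a
    pairWeight-sym []      a b = refl
    pairWeight-sym (e ∷ D) a b = cong₂ _+_
      (indicator-cong (joinsPair? a b e) (joinsPair? b a e) ⊎-swap ⊎-swap) (pairWeight-sym D a b)

    -- Double counting: an entry of `D` contributes to at most one unordered pair of colors of `L`.
    totalWeight-pairWeight : ∀ D {L} → Unique L → totalWeight (pairWeight D) L ≤ length D
    totalWeight-pairWeight []      {L} u = ≤-reflexive (totalWeight-0 L)
    totalWeight-pairWeight ((x , y) ∷ D) {L} u = ≤-trans
      (≤-reflexive (totalWeight-+ (λ a b → indicator (joins? (κ x) (κ y) a b)) (pairWeight D) L))
      (+-mono-≤ (totalWeight-≤1 (κ x) (κ y) u) (totalWeight-pairWeight D u))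

    pairWeight-≥1 : ∀ {D a b x y} → (x , y) ∈ D → Joins (κ x) (κ y) a b → 1 ≤ pairWeight D a b
    pairWeight-≥1 {D} {a} {b} e∈D j = subst (_≤ pairWeight D a b) (indicator-yes (joinsPair? a b _) j)
      (sum-map-∈ (indicator ∘ joinsPair? a b) e∈D)

    pairWeight-≥2 : ∀ {D a b x y x′ y′} → (x , y) ≢ (x′ , y′) → (x , y) ∈ D → (x′ , y′) ∈ D →
                    Joins (κ x) (κ y) a b → Joins (κ x′) (κ y′) a b → 2 ≤ pairWeight D a b
    pairWeight-≥2 {D} {a} {b} e≢ e∈D e′∈D j j′ = subst (_≤ pairWeight D a b)
      (cong₂ _+_ (indicator-yes (joinsPair? a b _) j) (indicator-yes (joinsPair? a b _) j′))
      (sum-map-∈₂ (indicator ∘ joinsPair? a b) e≢ e∈D e′∈D)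

-- Palettes, blocked colors and extensions

⊎-∀ : ∀ {n} {Q : Fin n → Set} → (∀ j → A ⊎ Q j) → A ⊎ (∀ j → Q j)
⊎-∀ {n = zero}  f = inj₂ λ ()
⊎-∀ {n = suc n} f with f zero | ⊎-∀ (f ∘ suc)
... | inj₁ a | _       = inj₁ a
... | inj₂ _ | inj₁ a  = inj₁ a
... | inj₂ q | inj₂ qs = inj₂ (∀-cons q qs)

-- The pairs of a matching serve as two-color palettes and the unmatched colors as the last one.
palette : (M : List (V × V)) → List V → Fin (suc (length M)) → List V
palette []            S zero    = S
palette ((a , b) ∷ M) S zero    = a ∷ b ∷ []
palette (_ ∷ M)       S (suc i) = palette M S i

palette⊆ : ∀ (M : List (V × V)) {S} i {x} → x ∈ palette M S i → x ∈ flat M ++ S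
palette⊆ []      zero    x∈                  = x∈
palette⊆ (_ ∷ M) zero    (here refl)         = here refl
palette⊆ (_ ∷ M) zero    (there (here refl)) = there (here refl)
palette⊆ (_ ∷ M) (suc i) x∈                  = there (there (palette⊆ M i x∈))

head-disjoint : {a b x : V} {xs : List V} → All (a ≢_) xs → All (b ≢_) xs →
                x ∈ a ∷ b ∷ [] → ¬ x ∈ xs
head-disjoint a∉ b∉ (here refl)         x∈ = All.lookup a∉ x∈ refl
head-disjoint a∉ b∉ (there (here refl)) x∈ = All.lookup b∉ x∈ refl

palette-disjoint : ∀ (M : List (V × V)) {S} → Unique (flat M ++ S) → ∀ i j {x} →
                   x ∈ palette M S i → x ∈ palette M S j → i ≡ j
palette-disjoint []      u zero    zero    x∈ x∈′ = refl
palette-disjoint (_ ∷ M) u zero    zero    x∈ x∈′ = refl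
palette-disjoint (_ ∷ M) (_ ∷ _ ∷ u) (suc i) (suc j) x∈ x∈′ = cong suc (palette-disjoint M u i j x∈ x∈′)
palette-disjoint (_ ∷ M) ((_ ∷ a∉) ∷ b∉ ∷ _) zero (suc j) x∈ x∈′ =
  ⊥-elim (head-disjoint a∉ b∉ x∈ (palette⊆ M j x∈′))
palette-disjoint (_ ∷ M) ((_ ∷ a∉) ∷ b∉ ∷ _) (suc i) zero x∈ x∈′ =
  ⊥-elim (head-disjoint a∉ b∉ x∈′ (palette⊆ M i x∈))

transpose-first : ∀ {m} (i j : Fin m) → transpose i j i ≡ j
transpose-first i j rewrite dec-true (i ≟ᶠ i) refl = refl

module _ {n N : ℕ} (G : Graph n) (P : Subset n) (κ : Fin n → Fin N) where

  private
    w : Fin N → Fin N → ℕ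
    w = pairWeight κ (𝒟 G P 2)

  Blocked : Fin n → Fin N → Set
  Blocked v a = ∃ λ x → x ∈ˢ P × Adj G v x × κ x ≡ a

  blocked? : ∀ v a → Dec (Blocked v a)
  blocked? v a = any? λ x → x ∈ˢ? P ×-dec adj? G v x ×-dec κ x ≟ᶠ a

  commonNeighbor⇒distance≤2 : ∀ {v x y} → Adj G v x → Adj G v y → Distance≤ G 2 x y
  commonNeighbor⇒distance≤2 {v} {x} {y} vx vy =
    let walk      = v , adj-sym G vx , y , vy , refl
        (l , isD) = least (walk? G x y) 2 walk
    in l , isD , proj₂ isD 2 walk

  commonNeighbor⇒∈𝒟 : ∀ {v x y} → x ∈ˢ P → y ∈ˢ P → x ≢ y → Adj G v x → Adj G v y →
                      (x , y) ∈ 𝒟 G P 2 ⊎ (y , x) ∈ 𝒟 G P 2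
  commonNeighbor⇒∈𝒟 {v} {x} {y} x∈P y∈P x≢y vx vy with <-cmp x y
  ... | tri≈ _ x≡y _ = contradiction x≡y x≢y
  ... | tri< x<y _ _ = inj₁ (∈-filter⁺ (inD? G P 2) (∈-cartesianProduct⁺ (∈-allFin x) (∈-allFin y))
                              (x<y , x∈P , y∈P , commonNeighbor⇒distance≤2 vx vy))
  ... | tri> _ _ y<x = inj₂ (∈-filter⁺ (inD? G P 2) (∈-cartesianProduct⁺ (∈-allFin y) (∈-allFin x))
                              (y<x , y∈P , x∈P , commonNeighbor⇒distance≤2 vy vx))

  -- The blocking vertices have the common neighbor `v` and differ because their colors do.
  -- `Joins p q x y` records which vertices form the pair, so that two such pairs can be told apart.
  blocked⇒pair : ∀ {v a b} → a ≢ b → ((x , _) : Blocked v a) ((y , _) : Blocked v b) →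
                 ∃₂ λ p q → (p , q) ∈ 𝒟 G P 2 × Joins (κ p) (κ q) a b × Joins p q x y
  blocked⇒pair a≢b (x , x∈P , vx , refl) (y , y∈P , vy , refl)
    with commonNeighbor⇒∈𝒟 x∈P y∈P (a≢b ∘ cong κ) vx vy
  ... | inj₁ e∈ = x , y , e∈ , inj₁ (refl , refl) , inj₁ (refl , refl)
  ... | inj₂ e∈ = y , x , e∈ , inj₂ (refl , refl) , inj₂ (refl , refl)

  zero⇒¬blocked : ∀ {v a b} → a ≢ b → w a b ≡ 0 → Blocked v a → ¬ Blocked v b
  zero⇒¬blocked a≢b w≡0 β β′ with p , q , e∈ , j , _ ← blocked⇒pair a≢b β β′ =
    contradiction w≡0 (>⇒≢ (pairWeight-≥1 κ e∈ j))

  Extension : Set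
  Extension = ∃ λ (f : Coloring G N) → ∀ v → v ∈ˢ P → color f v ≡ κ v

  -- Adjacent vertices outside `P` lie in different classes and hence draw on disjoint palettes;
  -- between a vertex of `P` and one outside, a conflict would mean a blocked color.
  extend : (∀ x y → x ∈ˢ P → y ∈ˢ P → Adj G x y → κ x ≢ κ y) →
           ∀ {m} (c : Coloring G m) {Π : Fin m → List (Fin N)} →
           (∀ i j {a} → a ∈ Π i → a ∈ Π j → i ≡ j) →
           (∀ v → v ∉ˢ P → ∃ λ a → a ∈ Π (color c v) × ¬ Blocked v a) → Extension
  extend κ-proper c {Π} disjoint free = record { color = f ; proper = f-proper } , f-κ
    where
    f : Fin n → Fin N
    f v with v ∈ˢ? P
    ... | yes _  = κ v
    ... | no v∉P = proj₁ (free v v∉P)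
    f-κ : ∀ v → v ∈ˢ P → f v ≡ κ v
    f-κ v v∈P with v ∈ˢ? P
    ... | yes _  = refl
    ... | no v∉P = contradiction v∈P v∉P
    f-proper : IsProper G f
    f-proper x y xy with x ∈ˢ? P | y ∈ˢ? P
    ... | yes x∈P | yes y∈P = κ-proper x y x∈P y∈P xy
    ... | yes x∈P | no y∉P  = λ eq → proj₂ (proj₂ (free y y∉P)) (x , x∈P , adj-sym G xy , eq)
    ... | no x∉P  | yes y∈P = λ eq → proj₂ (proj₂ (free x x∉P)) (y , y∈P , xy , sym eq)
    ... | no x∉P  | no y∉P  with a , a∈ , _ ← free x x∉P | b , b∈ , _ ← free y y∉P =
      λ { refl → proper c x y xy (disjoint _ _ a∈ b∈) }

  Stuck : ∀ {m} → Coloring G m → List (Fin N) → Fin m → Set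
  Stuck c S j = ∃ λ v → color c v ≡ j × All (Blocked v) S

  -- If both colors of a matched pair were blocked at `v`, the two blocking vertices would give that
  -- pair positive weight. So only the last palette, with index `fromℕ (length M)`, can fail.
  palette-free : ∀ M {S v} → Unique (flat M ++ S) → All (Zero w) M → ∀ i →
                 (i ≡ fromℕ (length M) × All (Blocked v) S) ⊎ ∃ λ a → a ∈ palette M S i × ¬ Blocked v a
  palette-free [] {S} {v} u z zero with all? (blocked? v) S
  ... | yes β = inj₁ (refl , β)
  ... | no ¬β = inj₂ (find (¬All⇒Any¬ (blocked? v) S ¬β))
  palette-free ((a , b) ∷ M) {v = v} ((a≢b ∷ _) ∷ _) (ab≡0 ∷ _) zero with blocked? v a
  ... | no ¬β = inj₂ (a , here refl , ¬β)
  ... | yes β = inj₂ (b , there (here refl) , zero⇒¬blocked a≢b ab≡0 β)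
  palette-free (_ ∷ M) (_ ∷ _ ∷ u) (_ ∷ z) (suc i) with palette-free M u z i
  ... | inj₁ (refl , β) = inj₁ (refl , β)
  ... | inj₂ free       = inj₂ free

  module _ (κ-proper : ∀ x y → x ∈ˢ P → y ∈ˢ P → Adj G x y → κ x ≢ κ y) where

    extension⊎stuck-last : ∀ {M S} (c : Coloring G (suc (length M))) → Unique (flat M ++ S) →
                           All (Zero w) M →
                           Extension ⊎ Stuck c S (fromℕ (length M))
    extension⊎stuck-last {M} {S} c u z
      with any? (λ v → color c v ≟ᶠ fromℕ (length M) ×-dec all? (blocked? v) S)
    ... | yes stuck = inj₂ stuck
    ... | no ¬stuck = inj₁ (extend κ-proper c (palette-disjoint M u) free)
      where
      free : ∀ v → v ∉ˢ P → ∃ λ a → a ∈ palette M S (color c v) × ¬ Blocked v a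
      free v _ = [ (λ (eq , β) → contradiction (v , eq , β) ¬stuck) , id ]′
                   (palette-free M u z (color c v))

    -- Any class can receive `S`: transposing class `j` with the last one gives another proper
    -- coloring, and a vertex stuck for it is carried back to class `j`.
    extension⊎stuck : ∀ {M S} (c : Coloring G (suc (length M))) → Unique (flat M ++ S) →
                      All (Zero w) M → Extension ⊎ (∀ j → Stuck c S j)
    extension⊎stuck {M} {S} c u z = ⊎-∀ λ j → Sum.map₂ (back j) (extension⊎stuck-last (swapped j) u z)
      where
      t : Fin (suc (length M))
      t = fromℕ (length M)
      swapped : Fin (suc (length M)) → Coloring G (suc (length M))
      swapped j = record
        { color  = transpose j t ∘ color c
        ; proper = λ x y xy eq → proper c x y xy
            (trans (sym (transpose-inverse t j)) (trans (cong (transpose t j) eq) (transpose-inverse t j))) }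
      back : ∀ j → Stuck (swapped j) S t → Stuck c S j
      back j (v , eq , β) =
        v , trans (sym (transpose-inverse t j)) (trans (cong (transpose t j) eq) (transpose-first t j)) , β

    -- A vertex x of P is not adjacent to the stuck vertex of its own class, so each color
    -- of S occurs at two different vertices of P.
    stuck⇒heavy : ∀ {m S} (c : Coloring G (suc m)) → (∀ j → Stuck c S j) → Unique S →
                  AllPairs (λ a b → 2 ≤ w a b) S
    stuck⇒heavy {S = S} c stuck = Unique⇒AllPairs heavy
      where
      heavy : ∀ {a b} → a ∈ S → b ∈ S → a ≢ b → 2 ≤ w a b
      heavy {a} {b} a∈ b∈ a≢b
        with v , _ , β ← stuck zero
        with x , x∈P , vx , κx ← All.lookup β a∈ | y , y∈P , vy , κy ← All.lookup β b∈
        with v′ , cv′ , β′ ← stuck (color c x)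
        with x′ , x′∈P , vx′ , κx′ ← All.lookup β′ a∈ | y′ , y′∈P , vy′ , κy′ ← All.lookup β′ b∈
        with p , q , e∈ , j , i ← blocked⇒pair a≢b (x , x∈P , vx , κx) (y , y∈P , vy , κy)
           | p′ , q′ , e′∈ , j′ , i′ ← blocked⇒pair a≢b (x′ , x′∈P , vx′ , κx′) (y′ , y′∈P , vy′ , κy′)
        = pairWeight-≥2 κ e≢e′ e∈ e′∈ j j′
        where
        -- If the pairs coincide, then x is x′, which is adjacent to v′ in the class of x, or x is
        -- y′, which would have both colors a and b.
        e≢e′ : (p , q) ≢ (p′ , q′)
        e≢e′ refl with Joins-meet i i′
        ... | inj₁ refl = proper c v′ x vx′ cv′
        ... | inj₂ refl = a≢b (trans (sym κx) κy′)

    -- The hypothesis `heavy` of the exchange argument, with `Extension` for `E` and the full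
    -- palette for `L`.
    extension⊎heavy : ∀ {m M S} → Coloring G (suc m) → flat M ++ S ↭ allFin N → length M ≡ m →
                      All (Zero w) M → Extension ⊎ AllPairs (λ a b → 2 ≤ w a b) S
    extension⊎heavy {M = M} c p refl z = Sum.map₂ (λ stuck → stuck⇒heavy c stuck (AllPairs-++⁻ʳ (flat M) u))
                                                  (extension⊎stuck c u z)
      where
      u : Unique (flat M ++ _)
      u = Unique-resp-↭ (↭-sym p) (allFin⁺ N)

    -- The total weight is at most |𝒟|. The first numerical hypothesis thus excludes a deficient
    -- structure, so `m` disjoint zero pairs exist; the second excludes that every exchange fails.
    extension : ∀ {m} → Coloring G (suc m) → 2 * m + 3 ≤ N →
                (∀ p q σ → p + q < m → p + (σ + 2 * q) ≡ N →
                  2 * ∣𝒟∣ G P 2 < (σ ∸ 1) * (σ + 4 * q)) →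
                (∀ {σ} → 2 * m + σ ≡ N → ∣𝒟∣ G P 2 < σ * (2 * m + (σ ∸ 1))) → Extension
    extension {m} c 2m+3≤N few few′ = [ exchange , deficient ]′ (matching⊎deficient w w-sym m L)
      where
      L : List (Fin N)
      L = allFin N
      ∣L∣≡N : length L ≡ N
      ∣L∣≡N = length-tabulate id
      w-sym : ∀ a b → w a b ≡ w b a
      w-sym = pairWeight-sym κ (𝒟 G P 2)
      W≤∣𝒟∣ : totalWeight w L ≤ ∣𝒟∣ G P 2
      W≤∣𝒟∣ = totalWeight-pairWeight κ (𝒟 G P 2) (allFin⁺ N)
      deficient : (∃ λ m′ → m′ < m × Deficient w w-sym m′ L) → Extension
      deficient (_ , m′<m , p , q , σ , refl , ≡∣L∣ , ≤W) =
        contradiction (few p q σ m′<m (trans ≡∣L∣ ∣L∣≡N)) (≤⇒≯ (≤-trans ≤W (*-monoʳ-≤ 2 W≤∣𝒟∣)))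
      exchange : Matching w w-sym m L → Extension
      exchange μ with exchange-bound w w-sym (extension⊎heavy c) μ (≤-trans 2m+3≤N (≤-reflexive (sym ∣L∣≡N)))
      ... | inj₁ ε = ε
      ... | inj₂ (σ , ≡∣L∣ , ≤W) =
        contradiction (few′ (trans ≡∣L∣ ∣L∣≡N)) (≤⇒≯ (≤-trans ≤W W≤∣𝒟∣))

-- Arithmetic of the two thresholds, with r = 2 + (p + q + g) and k = r + 1 + e

-- The left side is (k + 3r - 4)(k - r + 3) and the right side is (σ - 1)(σ + 4q) for σ = 5 + p + 2g
-- + e. Equality holds for p = g = 0.
threshold₁ : ∀ p q g e → 7 + 2 * e ≤ p + q + g →
             (5 + 4 * p + 4 * q + 4 * g + e) * (4 + e) ≤ (4 + p + 2 * g + e) * (5 + p + 2 * g + e + 4 * q)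
threshold₁ p q g e h = begin
  (5 + 4 * p + 4 * q + 4 * g + e) * (4 + e)
    ≡⟨ e₁ p q g e ⟩
  (4 + e) * T + (4 + e) * (3 * p + 2 * g)
    -- Raising 2g to 6g makes the second summand 3(4 + e)(p + 2g), and 3(4 + e) = (5 + e) + (7 + 2e)
    -- exposes the left side of the hypothesis.
    ≤⟨ +-monoʳ-≤ ((4 + e) * T) (*-monoʳ-≤ (4 + e) (+-monoʳ-≤ (3 * p) (*-monoˡ-≤ g (m≤m+n 2 4)))) ⟩
  (4 + e) * T + (4 + e) * (3 * p + 6 * g)
    ≡⟨ e₂ p q g e ⟩
  (4 + e) * T + (p + 2 * g) * (5 + e + (7 + 2 * e))
    ≤⟨ +-monoʳ-≤ ((4 + e) * T)
         (*-monoʳ-≤ (p + 2 * g) (+-monoʳ-≤ (5 + e) (≤-trans h (m≤m+n _ (g + 3 * q))))) ⟩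
  (4 + e) * T + (p + 2 * g) * (5 + e + (p + q + g + (g + 3 * q)))
    ≡⟨ e₃ p q g e ⟩
  (4 + p + 2 * g + e) * T ∎
  where
  open ≤-Reasoning
  T : ℕ
  T = 5 + p + 2 * g + e + 4 * q
  e₁ : ∀ p q g e → (5 + 4 * p + 4 * q + 4 * g + e) * (4 + e) ≡
       (4 + e) * (5 + p + 2 * g + e + 4 * q) + (4 + e) * (3 * p + 2 * g)
  e₁ = solve-∀
  e₂ : ∀ p q g e → (4 + e) * (5 + p + 2 * g + e + 4 * q) + (4 + e) * (3 * p + 6 * g) ≡
       (4 + e) * (5 + p + 2 * g + e + 4 * q) + (p + 2 * g) * (5 + e + (7 + 2 * e))
  e₂ = solve-∀
  e₃ : ∀ p q g e → (4 + e) * (5 + p + 2 * g + e + 4 * q) + (p + 2 * g) * (5 + e + (p + q + g + (g + 3 * q))) ≡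
       (4 + p + 2 * g + e) * (5 + p + 2 * g + e + 4 * q)
  e₃ = solve-∀

-- In terms of u = 4 + p + g + e, the left side (k + 1)(k + 2) is u(u + 1) + 2uq + q(q + 1), while
-- the right side is at least u(u + 1) + 4uq; so q + 1 ≤ 2u suffices. Equality holds for q = g = 0.
threshold₂ : ∀ p q g e → p + q + g ≤ 6 + 2 * e →
             (4 + p + q + g + e) * (5 + p + q + g + e) ≤ (4 + p + 2 * g + e) * (5 + p + 2 * g + e + 4 * q)
threshold₂ p q g e h = begin
  (4 + p + q + g + e) * (5 + p + q + g + e)      ≡⟨ e₁ q p g e ⟩
  u * suc u + 2 * u * q + q * suc q              ≤⟨ +-monoʳ-≤ (u * suc u + 2 * u * q) (*-monoʳ-≤ q 1+q≤2u) ⟩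
  u * suc u + 2 * u * q + q * (2 * u)            ≤⟨ m≤m+n _ (2 * u * g + g + g * g + 4 * (g * q)) ⟩
  u * suc u + 2 * u * q + q * (2 * u) + (2 * u * g + g + g * g + 4 * (g * q)) ≡⟨ e₂ p q g e ⟩
  (4 + p + 2 * g + e) * (5 + p + 2 * g + e + 4 * q) ∎
  where
  open ≤-Reasoning
  u : ℕ
  u = 4 + p + g + e
  e₀ : ∀ p g e → 2 * (4 + p + g + e) ≡ 7 + 2 * e + (1 + 2 * p + 2 * g)
  e₀ = solve-∀
  1+q≤2u : suc q ≤ 2 * u
  1+q≤2u = begin
    suc q                               ≤⟨ s≤s (≤-trans (m≤n+m q p) (m≤m+n (p + q) g)) ⟩
    suc (p + q + g)                     ≤⟨ s≤s h ⟩
    7 + 2 * e                           ≤⟨ m≤m+n _ _ ⟩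
    7 + 2 * e + (1 + 2 * p + 2 * g)     ≡⟨ e₀ p g e ⟨
    2 * u                               ∎
  e₁ : ∀ q p g e → (4 + p + q + g + e) * (5 + p + q + g + e) ≡
        (4 + p + g + e) * suc (4 + p + g + e) + 2 * (4 + p + g + e) * q + q * suc q
  e₁ = solve-∀
  e₂ : ∀ p q g e → (4 + p + g + e) * suc (4 + p + g + e) + 2 * (4 + p + g + e) * q + q * (2 * (4 + p + g + e)) +
       (2 * (4 + p + g + e) * g + g + g * g + 4 * (g * q)) ≡ (4 + p + 2 * g + e) * (5 + p + 2 * g + e + 4 * q)
  e₂ = solve-∀

m<n/2⇒2m<n : ∀ {m} n → m < n / 2 → 2 * m < n
m<n/2⇒2m<n {m} n m<n/2 = begin-strict
  2 * m       ≡⟨ *-comm 2 m ⟩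
  m * 2       <⟨ *-monoˡ-< 2 m<n/2 ⟩
  n / 2 * 2   ≤⟨ m/n*n≤m n 2 ⟩
  n           ∎
  where open ≤-Reasoning

-- Derivation of both cases from the two bounds

theorem8 : (r k : ℕ) → 2 ≤ r → r < k →
    ∀ {n} (G : Graph n) → χ G ≤ r →
    (P : Subset n) (d : Precoloring G P (r + k)) →
    (r < k → 2 * k + 7 ≤ 3 * r →
    ∣𝒟∣ G P 2 < (((k + 3 * r ∸ 4) * (k ∸ r + 3)) / 2) ⊓ ((k ∸ r + 2) * (k + r ∸ 1)) →
    ∃ λ (f : Coloring G (r + k)) → f Extends d)
    ×
    (2 * k + 7 > 3 * r →
    ∣𝒟∣ G P 2 < (((k + 1) * (k + 2)) / 2) ⊓ ((k ∸ r + 2) * (k + r ∸ 1)) →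
    ∃ λ (f : Coloring G (r + k)) → f Extends d)
-- Here ρ = r - 2 and e = k - r - 1. The two cases differ only in the derivation of `Few`.
theorem8 r@(suc (suc ρ)) k (s≤s (s≤s _)) r<k {n} G χ≤r P d with e , refl ← m≤n⇒∃[o]m+o≡n r<k =
    (λ _ 2k+7≤3r D< → conclude (few₁ 2k+7≤3r (<-≤-trans D< (m⊓n≤m _ _))) (<-≤-trans D< (m⊓n≤n _ _)))
  , (λ 2k+7>3r D< → conclude (few₂ 2k+7>3r (<-≤-trans D< (m⊓n≤m _ _))) (<-≤-trans D< (m⊓n≤n _ _)))
  where
  D : ℕ
  D = ∣𝒟∣ G P 2

  Few : Set
  Few = ∀ p q σ → p + q < suc ρ → p + (σ + 2 * q) ≡ r + k → 2 * D < (σ ∸ 1) * (σ + 4 * q)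

  κ : Fin n → Fin (r + k)
  -- The color `zero` outside `P` is a default: pairs of 𝒟 and blocking vertices lie in `P`.
  κ v with v ∈ˢ? P
  ... | yes v∈P = precolor d v v∈P
  ... | no _    = zero

  κ≡ : ∀ v v∈P → κ v ≡ precolor d v v∈P
  κ≡ v v∈P with v ∈ˢ? P
  ... | yes v∈P′ = cong (precolor d v) ([]=-irrelevant v∈P′ v∈P)
  ... | no v∉P   = contradiction v∈P v∉P

  κ-proper : ∀ x y → x ∈ˢ P → y ∈ˢ P → Adj G x y → κ x ≢ κ y
  κ-proper x y x∈P y∈P xy eq =
    preproper d x y x∈P y∈P xy (trans (sym (κ≡ x x∈P)) (trans eq (κ≡ y y∈P)))

  c : Coloring G r
  c = let c₀ = proj₁ (proj₂ (chromaticNumber G)) in record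
    { color  = λ v → inject≤ (color c₀ v) χ≤r
    ; proper = λ x y xy eq → proper c₀ x y xy (inject≤-injective χ≤r χ≤r _ _ eq) }

  k∸r : k ∸ r ≡ 1 + e
  k∸r = trans (cong (_∸ r) (sym (+-suc r e))) (m+n∸m≡n r (1 + e))

  few′ : D < (k ∸ r + 2) * (k + r ∸ 1) → ∀ {σ} → 2 * suc ρ + σ ≡ r + k → D < σ * (2 * suc ρ + (σ ∸ 1))
  few′ D< {σ} eq = subst (λ s → D < s * (2 * suc ρ + (s ∸ 1))) (sym σ≡)
                     (subst (D <_) (trans (cong (λ x → (x + 2) * (k + r ∸ 1)) k∸r) (e₂ ρ e)) D<)
    where
    e₁ : ∀ ρ e → 2 + ρ + (3 + ρ + e) ≡ 2 * suc ρ + (3 + e)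
    e₁ = solve-∀
    e₂ : ∀ ρ e → (1 + e + 2) * (2 + ρ + e + (2 + ρ)) ≡ (3 + e) * (2 * suc ρ + (2 + e))
    e₂ = solve-∀
    -- With r - 1 pairs matched, k - r + 2 colors remain, and the bound becomes the second
    -- threshold.
    σ≡ : σ ≡ 3 + e
    σ≡ = +-cancelˡ-≡ (2 * suc ρ) σ (3 + e) (trans eq (e₁ ρ e))

  few : ∀ {T} → 2 * D < T →
        (∀ p q g → p + q + g ≡ ρ → T ≤ (4 + p + 2 * g + e) * (5 + p + 2 * g + e + 4 * q)) → Few
  few {T} 2D<T T≤ p q σ (s≤s p+q≤ρ) eq = <-≤-trans 2D<T
    (subst (λ s → T ≤ (s ∸ 1) * (s + 4 * q)) (sym σ≡) (T≤ p q g p+q+g≡ρ))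
    where
    -- The number of pairs by which p + q falls short of r - 2; together with p and q it determines
    -- σ.
    g : ℕ
    g = proj₁ (m≤n⇒∃[o]m+o≡n p+q≤ρ)
    p+q+g≡ρ : p + q + g ≡ ρ
    p+q+g≡ρ = proj₂ (m≤n⇒∃[o]m+o≡n p+q≤ρ)
    e₁ : ∀ p q σ → p + 2 * q + σ ≡ p + (σ + 2 * q)
    e₁ = solve-∀
    e₂ : ∀ p q g e → 2 + (p + q + g) + (3 + (p + q + g) + e) ≡ p + 2 * q + (5 + p + 2 * g + e)
    e₂ = solve-∀
    σ≡ : σ ≡ 5 + p + 2 * g + e
    σ≡ = +-cancelˡ-≡ (p + 2 * q) σ _ (trans (e₁ p q σ) (trans eq
           (trans (cong (λ x → 2 + x + (3 + x + e)) (sym p+q+g≡ρ)) (e₂ p q g e))))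

  few₁ : 2 * k + 7 ≤ 3 * r → D < ((k + 3 * r ∸ 4) * (k ∸ r + 3)) / 2 → Few
  few₁ h D< = few (m<n/2⇒2m<n ((k + 3 * r ∸ 4) * (k ∸ r + 3)) D<) λ { p q g refl → ≤-trans
    (≤-reflexive (cong₂ _*_ (trans (cong (_∸ 4) (e₁ p q g e)) (m+n∸m≡n 4 _))
                            (trans (cong (_+ 3) k∸r) (+-comm (1 + e) 3))))
    (threshold₁ p q g e (+-cancelˡ-≤ (6 + 2 * (p + q + g)) _ _
      (≤-trans (≤-reflexive (e₂ (p + q + g) e)) (≤-trans h (≤-reflexive (e₃ (p + q + g))))))) }
    where
    e₁ : ∀ p q g e → 3 + (p + q + g) + e + 3 * (2 + (p + q + g)) ≡ 4 + (5 + 4 * p + 4 * q + 4 * g + e)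
    e₁ = solve-∀
    e₂ : ∀ ρ e → 6 + 2 * ρ + (7 + 2 * e) ≡ 2 * (3 + ρ + e) + 7
    e₂ = solve-∀
    e₃ : ∀ ρ → 3 * (2 + ρ) ≡ 6 + 2 * ρ + ρ
    e₃ = solve-∀

  few₂ : 2 * k + 7 > 3 * r → D < ((k + 1) * (k + 2)) / 2 → Few
  few₂ h D< = few (m<n/2⇒2m<n ((k + 1) * (k + 2)) D<) λ { p q g refl → ≤-trans
    (≤-reflexive (e₁ p q g e))
    (threshold₂ p q g e (≤-pred (+-cancelˡ-≤ (6 + 2 * (p + q + g)) _ _
      (≤-trans (≤-reflexive (e₃ (p + q + g))) (≤-trans h (≤-reflexive (e₂ (p + q + g) e))))))) }
    where
    e₁ : ∀ p q g e → (3 + (p + q + g) + e + 1) * (3 + (p + q + g) + e + 2) ≡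
         (4 + p + q + g + e) * (5 + p + q + g + e)
    e₁ = solve-∀
    e₂ : ∀ ρ e → 2 * (3 + ρ + e) + 7 ≡ 6 + 2 * ρ + (7 + 2 * e)
    e₂ = solve-∀
    e₃ : ∀ ρ → 6 + 2 * ρ + suc ρ ≡ suc (3 * (2 + ρ))
    e₃ = solve-∀

  conclude : Few → D < (k ∸ r + 2) * (k + r ∸ 1) → ∃ λ (f : Coloring G (r + k)) → f Extends d
  conclude fewᵢ D< = let (f , f≡κ) = extension G P κ κ-proper c size fewᵢ (few′ D<)
                     in f , λ v v∈P → trans (f≡κ v v∈P) (κ≡ v v∈P)
    where
    e₁ : ∀ ρ e → 2 + ρ + (3 + ρ + e) ≡ 2 * suc ρ + 3 + e
    e₁ = solve-∀
    size : 2 * suc ρ + 3 ≤ r + k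
    size = ≤-trans (m≤m+n _ e) (≤-reflexive (sym (e₁ ρ e)))
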